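{- Any process typable in the first (level-based, simple-type) system of Deng and Sangiorgi is typable in the input/output-type system: for every process $P$, if there are $\Gamma$ and $w$ with $\Gamma\vdash_D P:w$, then there are $\Gamma'$ and $w'$ with $\Gamma'\vdash P:w'$.
   Context: **Processes (polyadic).** Fix an infinite set of names $a,b,\dots,x,y,\dots$. Values: $v ::= \star\mid a$. Tuples of values and names are written $\tilde v,\tilde x$ (length $\ge 1$; the names in $\tilde x$ pairwise distinct). Processes: $P ::= \mathbf 0 \mid P_1|P_2 \mid \overline a\langle\tilde v\rangle \mid (\nu a)P \mid a(\tilde x).P \mid\, !a(\tilde x).P$. $(\nu a)P$ binds $a$; $a(\tilde x).P$ and $!a(\tilde x).P$ bind $\tilde x$ in $P$. Processes are implicitly assumed written so that all bound names are pairwise distinct and different from the free names, with implicit $\alpha$-renaming whenever needed. **Types.** $T ::= \sharp^{k}\tilde T \mid \mathsf i^{k}\tilde T \mid \mathsf o^{k}\tilde T \mid \mathbb U$, $k\in\mathbb N$ (the level), $\tilde T$ a non-empty tuple of types. Subtyping $\le$, extended componentwise to tuples of equal length, is the least reflexive and transitive relation such that: $\sharp^k\tilde T\le \mathsf i^k\tilde T$; $\sharp^k\tilde T\le\mathsf o^k\tilde T$; if $\tilde T\le \tilde S$ and $k_1\le k_2$ then $\mathsf i^{k_2}\tilde T\le\mathsf i^{k_1}\tilde S$; if $\tilde T\le \tilde S$ and $k_1\le k_2$ then $\mathsf o^{k_1}\tilde S\le\mathsf o^{k_2}\tilde T$. **Input/output-type system.** A typing environment $\Gamma$ is a partial map from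 names to types; $\Gamma,a:T$ is its extension, defined only when $a\notin\mathrm{dom}(\Gamma)$. Values: $\Gamma\vdash\star:\mathbb U$; $\Gamma\vdash a:T$ if $\Gamma(a)=T$; if $\Gamma\vdash a:T$ and $T\le U$ then $\Gamma\vdash a:U$; $\Gamma\vdash\tilde v:\tilde T$ means componentwise typing. Processes ($\Gamma\vdash P:w$, $w\in\mathbb N$): - $\Gamma\vdash\mathbf 0:0$; - if $\Gamma\vdash a:\mathsf o^k\tilde T$ and $\Gamma\vdash \tilde v:\tilde T$ then $\Gamma\vdash\overline a\langle \tilde v\rangle:k$; - if $\Gamma\vdash a:\mathsf i^k\tilde T$ and $\Gamma,\tilde x:\tilde T\vdash P:w$ then $\Gamma\vdash a(\tilde x).P:w$; - if $\Gamma\vdash a:\mathsf i^k\tilde T$, $\Gamma,\tilde x:\tilde T\vdash P:w$ and $k>w$ then $\Gamma\vdash\,!a(\tilde x).P:0$; - if $\Gamma,a:T\vdash P:w$ then $\Gamma\vdash(\nu a)P:w$; - if $\Gamma\vdash P_1:w_1$ and $\Gamma\vdash P_2:w_2$ then $\Gamma\vdash P_1|P_2:\max(w_1,w_2)$. **First Deng–Sangiorgi system, recast in this setting** ($\Gamma\vdash_D P:w$). Types are built only from $\mathbb U$ and $\sharp^k\tilde T$ (so no subtyping is available: $\Gamma\vdash_D a:T$ iff $\Gamma(a)=T$, and $\Gamma\vdash_D\star:\mathbb U$). The rules for processes are those just listed, with $\vdash_D$ in place of $\vdash$, except that in the rules for output, input and replicated input the first premise is replaced by $\Gamma\vdash_D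 a:\sharp^k\tilde T$. -}

module Defs where

open import Data.Empty using (⊥-elim)
open import Data.Maybe using (Maybe; just; nothing)
open import Data.Nat using (ℕ; suc; _≤_; _>_; _⊔_)
open import Data.Vec using (Vec; []; _∷_; map)
open import Data.Vec.Membership.Propositional using (_∈_; _∉_)
open import Data.Vec.Relation.Binary.Pointwise.Inductive using (Pointwise)
open import Data.Vec.Relation.Unary.All using (All)
open import Data.Vec.Relation.Unary.Unique.Propositional using (Unique)
open import Data.Vec.Relation.Unary.Unique.Propositional.Properties using (map⁺)
open import Function using (_↣_)
open import Relation.Binary.Definitions using (DecidableEquality)
open import Relation.Binary.PropositionalEquality using (_≡_; _≢_; refl; sym)
open import Relation.Nullary using (¬_; yes; no)

-- Non-empty tuples are vectors of length suc n throughout.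

data Type : Set where
  ♯ i o : ∀ {n} → ℕ → Vec Type (suc n) → Type
  𝕌     : Type

infix 4 _<:_

data _<:_ : Type → Type → Set where
  <:-refl  : ∀ {T} → T <: T
  <:-trans : ∀ {T U V} → T <: U → U <: V → T <: V
  ♯<:i     : ∀ {n k} {Ts : Vec Type (suc n)} → ♯ k Ts <: i k Ts
  ♯<:o     : ∀ {n k} {Ts : Vec Type (suc n)} → ♯ k Ts <: o k Ts
  i<:i     : ∀ {n k₁ k₂} {Ts Ss : Vec Type (suc n)} →
             Pointwise _<:_ Ts Ss → k₁ ≤ k₂ → i k₂ Ts <: i k₁ Ss
  o<:o     : ∀ {n k₁ k₂} {Ts Ss : Vec Type (suc n)} →
             Pointwise _<:_ Ts Ss → k₁ ≤ k₂ → o k₁ Ss <: o k₂ Ts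

-- The types of the first Deng–Sangiorgi system.

data Typeᴰ : Set where
  ♯ : ∀ {n} → ℕ → Vec Typeᴰ (suc n) → Typeᴰ
  𝕌 : Typeᴰ

record NameSet : Set₁ where
  field
    Name     : Set
    _≟_      : DecidableEquality Name
    infinite : ℕ ↣ Name

module Calculus (𝒩 : NameSet) where
  open NameSet 𝒩

  data Value : Set where
    ⋆    : Value
    name : Name → Value

  record Binder (n : ℕ) : Set where
    constructor binder
    field
      names     : Vec Name (suc n)
      .distinct : Unique names

  open Binder public using (names)

  infixr 6 _∥_

  data Process : Set where
    𝟎      : Process
    _∥_    : Process → Process → Process
    out    : ∀ {n} → Name → Vec Value (suc n) → Process
    ν      : Name → Process → Process
    inp    : ∀ {n} → Name → Binder n → Process → Process
    repinp : ∀ {n} → Name → Binder n → Process → Process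

  infix 4 _∈fn_ _∉fn_

  data _∈fn_ (c : Name) : Process → Set where
    ∥ˡ       : ∀ {P Q} → c ∈fn P → c ∈fn P ∥ Q
    ∥ʳ       : ∀ {P Q} → c ∈fn Q → c ∈fn P ∥ Q
    out-subj : ∀ {n} {vs : Vec Value (suc n)} → c ∈fn out c vs
    out-arg  : ∀ {n a} {vs : Vec Value (suc n)} → name c ∈ vs → c ∈fn out a vs
    ν        : ∀ {a P} → c ≢ a → c ∈fn P → c ∈fn ν a P
    inp-subj : ∀ {n} {xs : Binder n} {P} → c ∈fn inp c xs P
    inp-body : ∀ {n a} {xs : Binder n} {P} →
               c ∉ names xs → c ∈fn P → c ∈fn inp a xs P
    rep-subj : ∀ {n} {xs : Binder n} {P} → c ∈fn repinp c xs P
    rep-body : ∀ {n a} {xs : Binder n} {P} →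
               c ∉ names xs → c ∈fn P → c ∈fn repinp a xs P

  _∉fn_ : Name → Process → Set
  c ∉fn P = ¬ (c ∈fn P)

  -- swap a b exchanges a and b everywhere, binding occurrences included,
  -- so it never captures.

  swap : Name → Name → Name → Name
  swap a b c with c ≟ a | c ≟ b
  ... | yes _ | _     = b
  ... | no _  | yes _ = a
  ... | no _  | no _  = c

  swap-injective : ∀ a b {c d} → swap a b c ≡ swap a b d → c ≡ d
  swap-injective a b {c} {d} eq with c ≟ a | c ≟ b | d ≟ a | d ≟ b
  ... | yes refl | _        | yes refl | _        = refl
  ... | yes refl | _        | no d≢a   | yes refl = sym eq
  ... | yes refl | _        | no _     | no d≢b   = ⊥-elim (d≢b (sym eq))
  ... | no _     | yes refl | yes refl | _        = sym eq
  ... | no _     | yes refl | no _     | yes refl = refl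
  ... | no _     | yes refl | no d≢a   | no _     = ⊥-elim (d≢a (sym eq))
  ... | no _     | no c≢b   | yes refl | _        = ⊥-elim (c≢b eq)
  ... | no c≢a   | no _     | no _     | yes refl = ⊥-elim (c≢a eq)
  ... | no _     | no _     | no _     | no _     = eq

  swapᵛ : Name → Name → Value → Value
  swapᵛ a b ⋆        = ⋆
  swapᵛ a b (name c) = name (swap a b c)

  swapᵇ : ∀ {n} → Name → Name → Binder n → Binder n
  swapᵇ a b (binder xs u) = binder (map (swap a b) xs) (map⁺ (swap-injective a b) u)

  swapᵖ : Name → Name → Process → Process
  swapᵖ a b 𝟎               = 𝟎
  swapᵖ a b (P ∥ Q)         = swapᵖ a b P ∥ swapᵖ a b Q
  swapᵖ a b (out c vs)      = out (swap a b c) (map (swapᵛ a b) vs)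
  swapᵖ a b (ν c P)         = ν (swap a b c) (swapᵖ a b P)
  swapᵖ a b (inp c xs P)    = inp (swap a b c) (swapᵇ a b xs) (swapᵖ a b P)
  swapᵖ a b (repinp c xs P) = repinp (swap a b c) (swapᵇ a b xs) (swapᵖ a b P)

  -- In the renaming rules the new name is not free in the body, so up to
  -- α-equivalence the swap is the substitution of the new name for the old.
  -- Tuples are renamed one component at a time.

  infix 4 _≡α_

  data _≡α_ : Process → Process → Set where
    ≡α-refl    : ∀ {P} → P ≡α P
    ≡α-sym     : ∀ {P Q} → P ≡α Q → Q ≡α P
    ≡α-trans   : ∀ {P Q R} → P ≡α Q → Q ≡α R → P ≡α R
    ∥-cong     : ∀ {P P′ Q Q′} → P ≡α P′ → Q ≡α Q′ → P ∥ Q ≡α P′ ∥ Q′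
    ν-cong     : ∀ {a P P′} → P ≡α P′ → ν a P ≡α ν a P′
    inp-cong   : ∀ {n a} {xs : Binder n} {P P′} →
                 P ≡α P′ → inp a xs P ≡α inp a xs P′
    rep-cong   : ∀ {n a} {xs : Binder n} {P P′} →
                 P ≡α P′ → repinp a xs P ≡α repinp a xs P′
    ν-rename   : ∀ {a b P} → b ∉fn P → ν a P ≡α ν b (swapᵖ a b P)
    inp-rename : ∀ {n a x y} {xs : Binder n} {P} →
                 x ∈ names xs → y ∉ names xs → y ∉fn P →
                 inp a xs P ≡α inp a (swapᵇ x y xs) (swapᵖ x y P)
    rep-rename : ∀ {n a x y} {xs : Binder n} {P} →
                 x ∈ names xs → y ∉ names xs → y ∉fn P →
                 repinp a xs P ≡α repinp a (swapᵇ x y xs) (swapᵖ x y P)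

  -- Partial maps from names to types; A is Type or Typeᴰ.

  Env : Set → Set
  Env A = Name → Maybe A

  _∉dom_ : ∀ {A} → Name → Env A → Set
  a ∉dom Γ = Γ a ≡ nothing

  -- The operations below are total and would overwrite; the typing rules
  -- carry the ∉dom side condition under which Γ , a : T is defined.

  infixl 5 _▹_∶_ _▹▹_∶_

  _▹_∶_ : ∀ {A} → Env A → Name → A → Env A
  (Γ ▹ a ∶ T) b with b ≟ a
  ... | yes _ = just T
  ... | no _  = Γ b

  _▹▹_∶_ : ∀ {A n} → Env A → Vec Name n → Vec A n → Env A
  Γ ▹▹ []       ∶ []       = Γ
  Γ ▹▹ (x ∷ xs) ∶ (T ∷ Ts) = (Γ ▹ x ∶ T) ▹▹ xs ∶ Ts

  infix 4 _⊢ᵛ_∶_ _⊢_∶_ _⊢ᴰᵛ_∶_ _⊢ᴰ_∶_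

  data _⊢ᵛ_∶_ (Γ : Env Type) : Value → Type → Set where
    star : Γ ⊢ᵛ ⋆ ∶ 𝕌
    var  : ∀ {a T} → Γ a ≡ just T → Γ ⊢ᵛ name a ∶ T
    sub  : ∀ {a T U} → Γ ⊢ᵛ name a ∶ T → T <: U → Γ ⊢ᵛ name a ∶ U

  -- The rule alpha expresses that processes are taken up to α-renaming.

  data _⊢_∶_ : Env Type → Process → ℕ → Set where
    nil   : ∀ {Γ} → Γ ⊢ 𝟎 ∶ 0
    out   : ∀ {Γ n a k} {vs : Vec Value (suc n)} {Ts : Vec Type (suc n)} →
            Γ ⊢ᵛ name a ∶ o k Ts → Pointwise (Γ ⊢ᵛ_∶_) vs Ts →
            Γ ⊢ out a vs ∶ k
    inp   : ∀ {Γ n a k w} {xs : Binder n} {Ts P} →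
            Γ ⊢ᵛ name a ∶ i k Ts → All (_∉dom Γ) (names xs) →
            Γ ▹▹ names xs ∶ Ts ⊢ P ∶ w →
            Γ ⊢ inp a xs P ∶ w
    rep   : ∀ {Γ n a k w} {xs : Binder n} {Ts P} →
            Γ ⊢ᵛ name a ∶ i k Ts → All (_∉dom Γ) (names xs) →
            Γ ▹▹ names xs ∶ Ts ⊢ P ∶ w → k > w →
            Γ ⊢ repinp a xs P ∶ 0
    res   : ∀ {Γ a T w P} → a ∉dom Γ → Γ ▹ a ∶ T ⊢ P ∶ w → Γ ⊢ ν a P ∶ w
    par   : ∀ {Γ P₁ P₂ w₁ w₂} → Γ ⊢ P₁ ∶ w₁ → Γ ⊢ P₂ ∶ w₂ →
            Γ ⊢ P₁ ∥ P₂ ∶ w₁ ⊔ w₂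
    alpha : ∀ {Γ P Q w} → P ≡α Q → Γ ⊢ P ∶ w → Γ ⊢ Q ∶ w

  data _⊢ᴰᵛ_∶_ (Γ : Env Typeᴰ) : Value → Typeᴰ → Set where
    star : Γ ⊢ᴰᵛ ⋆ ∶ 𝕌
    var  : ∀ {a T} → Γ a ≡ just T → Γ ⊢ᴰᵛ name a ∶ T

  data _⊢ᴰ_∶_ : Env Typeᴰ → Process → ℕ → Set where
    nil   : ∀ {Γ} → Γ ⊢ᴰ 𝟎 ∶ 0
    out   : ∀ {Γ n a k} {vs : Vec Value (suc n)} {Ts : Vec Typeᴰ (suc n)} →
            Γ ⊢ᴰᵛ name a ∶ ♯ k Ts → Pointwise (Γ ⊢ᴰᵛ_∶_) vs Ts →
            Γ ⊢ᴰ out a vs ∶ k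
    inp   : ∀ {Γ n a k w} {xs : Binder n} {Ts P} →
            Γ ⊢ᴰᵛ name a ∶ ♯ k Ts → All (_∉dom Γ) (names xs) →
            Γ ▹▹ names xs ∶ Ts ⊢ᴰ P ∶ w →
            Γ ⊢ᴰ inp a xs P ∶ w
    rep   : ∀ {Γ n a k w} {xs : Binder n} {Ts P} →
            Γ ⊢ᴰᵛ name a ∶ ♯ k Ts → All (_∉dom Γ) (names xs) →
            Γ ▹▹ names xs ∶ Ts ⊢ᴰ P ∶ w → k > w →
            Γ ⊢ᴰ repinp a xs P ∶ 0
    res   : ∀ {Γ a T w P} → a ∉dom Γ → Γ ▹ a ∶ T ⊢ᴰ P ∶ w → Γ ⊢ᴰ ν a P ∶ w
    par   : ∀ {Γ P₁ P₂ w₁ w₂} → Γ ⊢ᴰ P₁ ∶ w₁ → Γ ⊢ᴰ P₂ ∶ w₂ →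
            Γ ⊢ᴰ P₁ ∥ P₂ ∶ w₁ ⊔ w₂
    alpha : ∀ {Γ P Q w} → P ≡α Q → Γ ⊢ᴰ P ∶ w → Γ ⊢ᴰ Q ∶ w

-- Reading ♯ of the simple types as ♯ of the input/output types preserves every
-- rule, since ♯ᵏT̃ lies below both oᵏT̃ and iᵏT̃; weights are unchanged.

module Submission where

open import Defs
open import Data.Maybe using (just)
import Data.Maybe as Maybe
open import Data.Product using (∃-syntax; _,_)
open import Data.Vec using (Vec; []; _∷_)
open import Data.Vec.Relation.Binary.Pointwise.Inductive using (Pointwise; []; _∷_)
import Data.Vec.Relation.Unary.All as All
open import Function using (_∘_)
open import Relation.Binary.PropositionalEquality
  using (_≡_; _≗_; refl; trans; cong)
open import Relation.Nullary using (yes; no)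

-- Simple types embed into input/output types, and induction on the simple derivation (`⊢-⟦⟧`)
-- rebuilds it rule by rule. The only new step is one subsumption at the subject of each output or
-- input; objects, levels and weights match exactly.

mutual

  ⟦_⟧ : Typeᴰ → Type
  ⟦ ♯ k Ts ⟧ = ♯ k ⟦ Ts ⟧*
  ⟦ 𝕌 ⟧      = 𝕌

  -- Spelled out instead of using `map ⟦_⟧`, so that the recursion is visibly structural.
  ⟦_⟧* : ∀ {n} → Vec Typeᴰ n → Vec Type n
  ⟦ [] ⟧*     = []
  ⟦ T ∷ Ts ⟧* = ⟦ T ⟧ ∷ ⟦ Ts ⟧*

module _ (𝒩 : NameSet) where
  open NameSet 𝒩
  open Calculus 𝒩

  ⟦_⟧ᵉ : Env Typeᴰ → Env Type
  ⟦ Γ ⟧ᵉ = Maybe.map ⟦_⟧ ∘ Γ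

  -- A pointwise relation because ⟦_⟧ᵉ commutes with extension only up to
  -- function extensionality; a record so that Γ and Δ can be inferred.

  record _Translates_ (Δ : Env Type) (Γ : Env Typeᴰ) : Set where
    constructor pointwise
    field at : Δ ≗ ⟦ Γ ⟧ᵉ

  open _Translates_

  ▹-⟦⟧ : ∀ {Γ Δ a T} → Δ Translates Γ → (Δ ▹ a ∶ ⟦ T ⟧) Translates (Γ ▹ a ∶ T)
  ▹-⟦⟧ {a = a} tr .at b with b ≟ a
  ... | yes _ = refl
  ... | no _  = tr .at b

  ▹▹-⟦⟧ : ∀ {Γ Δ n} (xs : Vec Name n) Ts → Δ Translates Γ →
          (Δ ▹▹ xs ∶ ⟦ Ts ⟧*) Translates (Γ ▹▹ xs ∶ Ts)
  ▹▹-⟦⟧ []       []       tr = tr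
  ▹▹-⟦⟧ (x ∷ xs) (T ∷ Ts) tr = ▹▹-⟦⟧ xs Ts (▹-⟦⟧ tr)

  -- Translation acts inside `just` only, so domains agree and freshness conditions transfer.
  ∉dom-⟦⟧ : ∀ {Γ Δ} → Δ Translates Γ → ∀ {a} → a ∉dom Γ → a ∉dom Δ
  ∉dom-⟦⟧ tr {a} a∉Γ = trans (tr .at a) (cong (Maybe.map ⟦_⟧) a∉Γ)

  lookup-⟦⟧ : ∀ {Γ Δ a T} → Δ Translates Γ → Γ a ≡ just T → Δ a ≡ just ⟦ T ⟧
  lookup-⟦⟧ {a = a} tr Γa = trans (tr .at a) (cong (Maybe.map ⟦_⟧) Γa)

  ⊢ᵛ-⟦⟧ : ∀ {Γ Δ v T} → Δ Translates Γ → Γ ⊢ᴰᵛ v ∶ T → Δ ⊢ᵛ v ∶ ⟦ T ⟧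
  ⊢ᵛ-⟦⟧ tr star     = star
  ⊢ᵛ-⟦⟧ tr (var Γa) = var (lookup-⟦⟧ tr Γa)

  ⊢ᵛ*-⟦⟧ : ∀ {Γ Δ n} {vs : Vec Value n} {Ts : Vec Typeᴰ n} → Δ Translates Γ →
           Pointwise (Γ ⊢ᴰᵛ_∶_) vs Ts → Pointwise (Δ ⊢ᵛ_∶_) vs ⟦ Ts ⟧*
  ⊢ᵛ*-⟦⟧ tr []       = []
  ⊢ᵛ*-⟦⟧ tr (d ∷ ds) = ⊢ᵛ-⟦⟧ tr d ∷ ⊢ᵛ*-⟦⟧ tr ds

  -- `Δ` is arbitrary up to pointwise agreement, so that the induction hypothesis applies to the
  -- extended environments under binders.
  ⊢-⟦⟧ : ∀ {Γ Δ P w} → Δ Translates Γ → Γ ⊢ᴰ P ∶ w → Δ ⊢ P ∶ w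
  ⊢-⟦⟧ tr nil         = nil
  ⊢-⟦⟧ tr (out a vs)  = out (sub (⊢ᵛ-⟦⟧ tr a) ♯<:o) (⊢ᵛ*-⟦⟧ tr vs)
  ⊢-⟦⟧ tr (inp {xs = xs} {Ts} a fresh d) =
    inp (sub (⊢ᵛ-⟦⟧ tr a) ♯<:i) (All.map (∉dom-⟦⟧ tr) fresh)
        (⊢-⟦⟧ (▹▹-⟦⟧ (names xs) Ts tr) d)
  ⊢-⟦⟧ tr (rep {xs = xs} {Ts} a fresh d k>w) =
    rep (sub (⊢ᵛ-⟦⟧ tr a) ♯<:i) (All.map (∉dom-⟦⟧ tr) fresh)
        (⊢-⟦⟧ (▹▹-⟦⟧ (names xs) Ts tr) d) k>w
  ⊢-⟦⟧ tr (res fresh d) =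
    res (∉dom-⟦⟧ tr fresh) (⊢-⟦⟧ (▹-⟦⟧ tr) d)
  ⊢-⟦⟧ tr (par d₁ d₂)   = par (⊢-⟦⟧ tr d₁) (⊢-⟦⟧ tr d₂)
  -- α-equivalence is untyped, so the same proof serves both systems.
  ⊢-⟦⟧ tr (alpha P≡Q d) = alpha P≡Q (⊢-⟦⟧ tr d)

lemma14 : (𝒩 : NameSet) → let open Calculus 𝒩 in
    (P : Process) →
    (∃[ Γ ] ∃[ w ] Γ ⊢ᴰ P ∶ w) →
    (∃[ Γ′ ] ∃[ w′ ] Γ′ ⊢ P ∶ w′)
lemma14 𝒩 P (Γ , w , d) = ⟦_⟧ᵉ 𝒩 Γ , w , ⊢-⟦⟧ 𝒩 (pointwise λ _ → refl) d
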